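{- Consider the Random Majority Model (RMM) on the cycle $C_n$ started from an initial coloring with $b_0=pn$ blue nodes, for some $0\le p\le 1$. Then $\mathbb{E}[b_t]=pn$ for every $t\in\mathbb{N}$, where $b_t$ is the number of blue nodes after round $t$.
   Context: A coloring is a map from the nodes to $\{b,w\}$. In RMM, all nodes update simultaneously in each round: a node adopts the color strictly more frequent among its neighbors in the previous round, and in case of a tie chooses blue or white independently and uniformly at random. -}

module Defs where

open import Data.Bool using (true; false)
open import Data.Fin using (Fin; toℕ)
open import Data.Integer using (+_)
open import Data.List using (length; filter; allFin)
open import Data.Nat as ℕ using (ℕ; zero; suc; s≤s)
open import Data.Nat.Properties as ℕ using (<-cmp)
open import Data.Product using (_×_; _,_)
open import Data.Rational using (ℚ; 0ℚ; 1ℚ; ½; _+_; _*_; _/_)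
open import Data.Rational.Properties using (*-1-commutativeMonoid)
open import Data.Sum using (_⊎_; inj₁; inj₂; swap)
open import Data.Vec using (Vec; []; _∷_; lookup; count)
open import Data.Vec.Properties using (≡-dec)
open import Relation.Binary using (Decidable; Symmetric; Irreflexive; DecidableEquality; tri<; tri≈; tri>)
open import Relation.Binary.PropositionalEquality using (_≡_; refl; sym; trans)
open import Relation.Nullary using (¬_; yes; no; does)
open import Relation.Nullary.Decidable using (_×-dec_; _⊎-dec_)
import Algebra.Properties.CommutativeMonoid.Sum as Sum

open Sum *-1-commutativeMonoid public using () renaming (sum to ∏)

fromℕ : ℕ → ℚ
fromℕ m = + m / 1

record SimpleGraph (n : ℕ) : Set₁ where
  field
    Adj       : Fin n → Fin n → Set
    adj?      : Decidable Adj
    symmetric : Symmetric Adj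
    loopless  : Irreflexive _≡_ Adj

-- Next i j : j is the cyclic successor of i, i.e. j ≡ i + 1 (mod n).
Next : ∀ {n} → Fin n → Fin n → Set
Next {n} i j = (toℕ j ≡ suc (toℕ i)) ⊎ (suc (toℕ i) ≡ n × toℕ j ≡ 0)

next? : ∀ {n} → Decidable (Next {n})
next? {n} i j = (toℕ j ℕ.≟ suc (toℕ i)) ⊎-dec ((suc (toℕ i) ℕ.≟ n) ×-dec (toℕ j ℕ.≟ 0))

¬next-refl : ∀ {n} → 3 ℕ.≤ n → (i : Fin n) → ¬ Next i i
¬next-refl _ i (inj₁ eq) = ℕ.1+n≢n (sym eq)
¬next-refl 3≤n i (inj₂ (last , first)) rewrite first | sym last with 3≤n
... | s≤s ()

cycle : (n : ℕ) → 3 ℕ.≤ n → SimpleGraph n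
cycle n 3≤n = record
  { Adj       = λ i j → Next i j ⊎ Next j i
  ; adj?      = λ i j → next? i j ⊎-dec next? j i
  ; symmetric = swap
  ; loopless  = λ { {i} refl (inj₁ q) → ¬next-refl 3≤n i q
                  ; {i} refl (inj₂ q) → ¬next-refl 3≤n i q }
  }

data Color : Set where
  blue white : Color

_≟ᶜ_ : DecidableEquality Color
blue  ≟ᶜ blue  = yes refl
blue  ≟ᶜ white = no λ ()
white ≟ᶜ blue  = no λ ()
white ≟ᶜ white = yes refl

opposite : Color → Color
opposite blue  = white
opposite white = blue

-- A map from the nodes to the colors, tabulated: node v has color lookup c v.
Coloring : ℕ → Set
Coloring n = Vec Color n

_≟_ : ∀ {n} → DecidableEquality (Coloring n)
_≟_ = ≡-dec _≟ᶜ_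

#blue : ∀ {n} → Coloring n → ℕ
#blue = count (_≟ᶜ blue)

∑Coloring : ∀ {n} → (Coloring n → ℚ) → ℚ
∑Coloring {zero}  f = f []
∑Coloring {suc n} f = ∑Coloring (λ c → f (blue ∷ c)) + ∑Coloring (λ c → f (white ∷ c))

module RMM {n : ℕ} (G : SimpleGraph n) where
  open SimpleGraph G

  #neighbors : Coloring n → Fin n → Color → ℕ
  #neighbors c v k = length (filter (λ u → adj? v u ×-dec (lookup c u ≟ᶜ k)) (allFin n))

  -- Probability that v has color k after one round from c.
  nodeProb : Coloring n → Fin n → Color → ℚ
  nodeProb c v k with <-cmp (#neighbors c v k) (#neighbors c v (opposite k))
  ... | tri< _ _ _ = 0ℚ
  ... | tri≈ _ _ _ = ½
  ... | tri> _ _ _ = 1ℚ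

  -- Transition probability from c to c′: given c, the nodes update
  -- simultaneously and independently, hence the product.
  stepProb : Coloring n → Coloring n → ℚ
  stepProb c c′ = ∏ (λ v → nodeProb c v (lookup c′ v))

  -- law c₀ t c is the probability that the coloring after round t is c, when
  -- the initial coloring is c₀.
  law : Coloring n → ℕ → Coloring n → ℚ
  law c₀ zero c with does (c₀ ≟ c)
  ... | true  = 1ℚ
  ... | false = 0ℚ
  law c₀ (suc t) c = ∑Coloring (λ c′ → law c₀ t c′ * stepProb c′ c)

  𝔼 : Coloring n → ℕ → (Coloring n → ℚ) → ℚ
  𝔼 c₀ t X = ∑Coloring (λ c → law c₀ t c * X c)

{-# OPTIONS --safe #-}

-- If every degree is 2, the color counts a, b around a node satisfy a + b = 2,
-- and in each of the cases (2,0), (1,1), (0,2) the node turns blue with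
-- probability a / 2.  Summing over the nodes, each blue node is counted once per
-- neighbor, so the expected number of blue nodes after one round is half of
-- 2 · #blue, that is, #blue is a martingale.  Of the cycle, only 2-regularity
-- is used.
module Submission where

open import Data.Bool using (true; false; if_then_else_)
open import Data.Empty using (⊥-elim)
open import Data.Fin using (Fin; zero; suc; toℕ; fromℕ<)
open import Data.Fin.Properties using (toℕ-injective; toℕ-fromℕ<; toℕ<n; suc-injective; 0≢1+n)
open import Data.Integer as ℤ using (+_)
open import Data.Integer.Properties as ℤ using ()
open import Data.List using (length; filter; tabulate)
open import Data.Nat as ℕ using (ℕ; zero; suc; s≤s)
open import Data.Nat.Properties as ℕ using (<-cmp)
open import Data.Product using (∃; _,_)
open import Data.Rational using (ℚ; 0ℚ; 1ℚ; ½; _+_; _*_; _≤_)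
open import Data.Rational.Properties as ℚ using ()
open import Data.Rational.Solver using (module +-*-Solver)
open import Data.Rational.Unnormalised as ℚᵘ using (mkℚᵘ; *≡*)
open import Data.Rational.Unnormalised.Properties as ℚᵘ using ()
open import Data.Sum using (inj₁; inj₂)
open import Data.Vec using ([]; _∷_; lookup)
open import Function using (_∘_; mk⇔)
open import Relation.Binary using (tri<; tri≈; tri>)
open import Relation.Binary.PropositionalEquality using (_≡_; refl; sym; trans; cong; cong₂; subst; module ≡-Reasoning)
open import Relation.Nullary using (¬_; Dec; yes; no; does)
open import Relation.Nullary.Decidable using (_×-dec_; _⊎-dec_; does-⇔)
open import Relation.Unary using (Decidable)
open import Algebra.Properties.Semiring.Sum ℕ.+-*-semiring using (*-distribˡ-sum; ∑-distrib-+; ∑-comm; sum-cong-≗; sum-replicate-zero) renaming (sum to ∑ℕ)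
open import Algebra.Properties.Monoid.Sum ℚ.+-0-monoid using () renaming (sum to ∑ℚ; sum-cong-≗ to ∑ℚ-cong)
open import Defs

open ≡-Reasoning

-- Natural numbers inside the rationals.

fromℕ-+ : ∀ a b → fromℕ (a ℕ.+ b) ≡ fromℕ a + fromℕ b
fromℕ-+ a b = ℚ.toℚᵘ-injective
  -- `_/_` divides by a gcd, which does not compute for variables. Unnormalised fractions with
  -- denominator 1 do, and there cross-multiplication leaves only factors 1 to remove.
  (ℚᵘ.≃-trans (ℚ.toℚᵘ-fromℚᵘ (i (a ℕ.+ b)))
  (ℚᵘ.≃-trans (*≡* (cong (ℤ._* + 1) (sym (cong₂ ℤ._+_ (ℤ.*-identityʳ (+ a)) (ℤ.*-identityʳ (+ b))))))
  (ℚᵘ.≃-trans (ℚᵘ.+-cong (ℚᵘ.≃-sym (ℚ.toℚᵘ-fromℚᵘ (i a))) (ℚᵘ.≃-sym (ℚ.toℚᵘ-fromℚᵘ (i b))))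
  (ℚᵘ.≃-sym (ℚ.toℚᵘ-homo-+ (fromℕ a) (fromℕ b))))))
  where
  i : ℕ → ℚᵘ.ℚᵘ
  i m = mkℚᵘ (+ m) 0

∑ℚ-½fromℕ : ∀ {n} (f : Fin n → ℕ) → ∑ℚ (λ v → ½ * fromℕ (f v)) ≡ ½ * fromℕ (∑ℕ f)
∑ℚ-½fromℕ {zero}  f = refl
∑ℚ-½fromℕ {suc n} f = begin
  ½ * fromℕ (f zero) + ∑ℚ (λ v → ½ * fromℕ (f (suc v)))  ≡⟨ cong (λ s → ½ * fromℕ (f zero) + s) (∑ℚ-½fromℕ (f ∘ suc)) ⟩
  ½ * fromℕ (f zero) + ½ * fromℕ (∑ℕ (f ∘ suc))          ≡⟨ ℚ.*-distribˡ-+ ½ (fromℕ (f zero)) (fromℕ (∑ℕ (f ∘ suc))) ⟨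
  ½ * (fromℕ (f zero) + fromℕ (∑ℕ (f ∘ suc)))            ≡⟨ cong (½ *_) (fromℕ-+ (f zero) _) ⟨
  ½ * fromℕ (∑ℕ f)                                       ∎

-- Finite sums over all colorings.

∑-cong : ∀ {n} {f g : Coloring n → ℚ} → (∀ c → f c ≡ g c) → ∑Coloring f ≡ ∑Coloring g
∑-cong {zero}  eq = eq []
∑-cong {suc n} eq = cong₂ _+_ (∑-cong (λ c → eq (blue ∷ c))) (∑-cong (λ c → eq (white ∷ c)))

∑-+ : ∀ {n} (f g : Coloring n → ℚ) → ∑Coloring (λ c → f c + g c) ≡ ∑Coloring f + ∑Coloring g
∑-+ {zero}  f g = refl
∑-+ {suc n} f g = trans (cong₂ _+_ (∑-+ (f ∘ (blue ∷_)) (g ∘ (blue ∷_))) (∑-+ (f ∘ (white ∷_)) (g ∘ (white ∷_))))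
  (solve 4 (λ a b c d → (a :+ b) :+ (c :+ d) := (a :+ c) :+ (b :+ d)) refl
    (∑Coloring (f ∘ (blue ∷_))) (∑Coloring (g ∘ (blue ∷_)))
    (∑Coloring (f ∘ (white ∷_))) (∑Coloring (g ∘ (white ∷_))))
  where open +-*-Solver

∑-*ˡ : ∀ {n} a (f : Coloring n → ℚ) → ∑Coloring (λ c → a * f c) ≡ a * ∑Coloring f
∑-*ˡ {zero}  a f = refl
∑-*ˡ {suc n} a f = trans
  (cong₂ _+_ (∑-*ˡ a (f ∘ (blue ∷_))) (∑-*ˡ a (f ∘ (white ∷_))))
  (sym (ℚ.*-distribˡ-+ a (∑Coloring (f ∘ (blue ∷_))) (∑Coloring (f ∘ (white ∷_)))))

∑-*ʳ : ∀ {n} a (f : Coloring n → ℚ) → ∑Coloring (λ c → f c * a) ≡ ∑Coloring f * a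
∑-*ʳ {zero}  a f = refl
∑-*ʳ {suc n} a f = trans
  (cong₂ _+_ (∑-*ʳ a (f ∘ (blue ∷_))) (∑-*ʳ a (f ∘ (white ∷_))))
  (sym (ℚ.*-distribʳ-+ a (∑Coloring (f ∘ (blue ∷_))) (∑Coloring (f ∘ (white ∷_)))))

∑-swap : ∀ {m n} (f : Coloring m → Coloring n → ℚ) →
  ∑Coloring (λ c → ∑Coloring (f c)) ≡ ∑Coloring (λ d → ∑Coloring (λ c → f c d))
∑-swap {zero}  f = refl
∑-swap {suc m} f = trans
  (cong₂ _+_ (∑-swap (f ∘ (blue ∷_))) (∑-swap (f ∘ (white ∷_))))
  (sym (∑-+ (λ d → ∑Coloring (λ c → f (blue ∷ c) d)) (λ d → ∑Coloring (λ c → f (white ∷ c) d))))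

∑-zero : ∀ {n} (f : Coloring n → ℚ) → (∀ c → f c ≡ 0ℚ) → ∑Coloring f ≡ 0ℚ
∑-zero {zero}  f eq = eq []
∑-zero {suc n} f eq = cong₂ _+_ (∑-zero _ (λ c → eq (blue ∷ c))) (∑-zero _ (λ c → eq (white ∷ c)))

-- Point mass at `c`: the law after zero rounds, stated without reference to a graph.
δ : ∀ {n} → Coloring n → Coloring n → ℚ
δ c d = if does (c ≟ d) then 1ℚ else 0ℚ

∑-δ : ∀ {n} (c : Coloring n) (X : Coloring n → ℚ) → ∑Coloring (λ d → δ c d * X d) ≡ X c
∑-δ []          X = ℚ.*-identityˡ (X [])
-- On colorings with the other first color `δ` computes to 0, so that half of the sum vanishes; on
-- the remaining half it computes to `δ` of the tails.
∑-δ (blue ∷ c)  X = trans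
  (cong₂ _+_ (∑-δ c (λ d → X (blue ∷ d))) (∑-zero _ (λ d → ℚ.*-zeroˡ (X (white ∷ d)))))
  (ℚ.+-identityʳ _)
∑-δ (white ∷ c) X = trans
  (cong₂ _+_ (∑-zero _ (λ d → ℚ.*-zeroˡ (X (blue ∷ d)))) (∑-δ c (λ d → X (white ∷ d))))
  (ℚ.+-identityˡ _)

-- Product distributions on colorings.

productMass : ∀ {n} → (Fin n → Color → ℚ) → Coloring n → ℚ
productMass f c = ∏ (λ v → f v (lookup c v))

∑-productMass : ∀ {n} (f : Fin n → Color → ℚ) → (∀ v → f v blue + f v white ≡ 1ℚ) →
  ∑Coloring (productMass f) ≡ 1ℚ
∑-productMass {zero}  f total = refl
∑-productMass {suc n} f total = begin
  ∑Coloring (λ c → f zero blue * productMass f′ c) + ∑Coloring (λ c → f zero white * productMass f′ c)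
    ≡⟨ cong₂ _+_ (∑-*ˡ (f zero blue) (productMass f′)) (∑-*ˡ (f zero white) (productMass f′)) ⟩
  f zero blue * M + f zero white * M
    ≡⟨ ℚ.*-distribʳ-+ M (f zero blue) (f zero white) ⟨
  (f zero blue + f zero white) * M
    ≡⟨ cong₂ _*_ (total zero) (∑-productMass f′ (total ∘ suc)) ⟩
  1ℚ ∎
  where
  f′ = f ∘ suc
  M = ∑Coloring (productMass f′)

-- Linearity of expectation, by induction on the nodes. If `S` is the expected count on the tail, a
-- blue head (weight `b`) gives `1 + S` and a white head (weight `w`) gives `S`; as `b + w` is 1,
-- the total is `b + S`. That the tail has mass 1 is needed for the summand 1.
∑-productMass-#blue : ∀ {n} (f : Fin n → Color → ℚ) → (∀ v → f v blue + f v white ≡ 1ℚ) →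
  ∑Coloring (λ c → productMass f c * fromℕ (#blue c)) ≡ ∑ℚ (λ v → f v blue)
∑-productMass-#blue {zero}  f total = refl
∑-productMass-#blue {suc n} f total = begin
  ∑Coloring (λ c → (b * P c) * fromℕ (suc (#blue c))) + ∑Coloring (λ c → (w * P c) * B c)
    ≡⟨ cong₂ _+_ (∑-cong expand) (∑-cong (λ c → ℚ.*-assoc w (P c) (B c))) ⟩
  ∑Coloring (λ c → b * (P c + P c * B c)) + ∑Coloring (λ c → w * (P c * B c))
    ≡⟨ cong₂ _+_ (trans (∑-*ˡ b (λ c → P c + P c * B c)) (cong (b *_) (∑-+ P (λ c → P c * B c)))) (∑-*ˡ w (λ c → P c * B c)) ⟩
  b * (∑Coloring P + S) + w * S
    ≡⟨ cong (λ m → b * (m + S) + w * S) (∑-productMass f′ (total ∘ suc)) ⟩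
  b * (1ℚ + S) + w * S
    ≡⟨ solve 3 (λ b w S → b :* (con 1ℚ :+ S) :+ w :* S := b :+ (b :+ w) :* S) refl b w S ⟩
  b + (b + w) * S
    ≡⟨ cong (λ m → b + m * S) (total zero) ⟩
  b + 1ℚ * S
    ≡⟨ cong (λ m → b + m) (trans (ℚ.*-identityˡ S) (∑-productMass-#blue f′ (total ∘ suc))) ⟩
  b + ∑ℚ (λ v → f′ v blue) ∎
  where
  open +-*-Solver
  f′ = f ∘ suc
  b = f zero blue
  w = f zero white
  P = productMass f′
  B : Coloring n → ℚ
  B c = fromℕ (#blue c)
  S = ∑Coloring (λ c → P c * B c)
  expand : ∀ c → (b * P c) * fromℕ (suc (#blue c)) ≡ b * (P c + P c * B c)
  expand c = trans (cong ((b * P c) *_) (fromℕ-+ 1 (#blue c)))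
    (solve 3 (λ b p x → (b :* p) :* (con 1ℚ :+ x) := b :* (p :+ p :* x)) refl b (P c) (B c))

-- Iverson brackets and counting.

⟦_⟧ : {P : Set} → Dec P → ℕ
⟦ p? ⟧ = if does p? then 1 else 0

⟦⟧-⇔ : {P Q : Set} → (P → Q) → (Q → P) → (p? : Dec P) (q? : Dec Q) → ⟦ p? ⟧ ≡ ⟦ q? ⟧
⟦⟧-⇔ to from p? q? = cong (if_then 1 else 0) (does-⇔ (mk⇔ to from) p? q?)

⟦×⟧ : {P Q : Set} (p? : Dec P) (q? : Dec Q) → ⟦ p? ×-dec q? ⟧ ≡ ⟦ p? ⟧ ℕ.* ⟦ q? ⟧
⟦×⟧ (yes _) q? = sym (ℕ.+-identityʳ ⟦ q? ⟧)
⟦×⟧ (no _)  q? = refl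

⟦⊎⟧ : {P Q : Set} → (P → ¬ Q) → (p? : Dec P) (q? : Dec Q) → ⟦ p? ⊎-dec q? ⟧ ≡ ⟦ p? ⟧ ℕ.+ ⟦ q? ⟧
⟦⊎⟧ disj (yes p) (yes q) = ⊥-elim (disj p q)
⟦⊎⟧ disj (yes p) (no _)  = refl
⟦⊎⟧ disj (no _)  q?      = refl

⟦¬⟧ : {P : Set} → ¬ P → (p? : Dec P) → ⟦ p? ⟧ ≡ 0
⟦¬⟧ ¬p (yes p) = ⊥-elim (¬p p)
⟦¬⟧ ¬p (no _)  = refl

length-filter-tabulate : ∀ {A : Set} {P : A → Set} (P? : Decidable P) {n} (g : Fin n → A) →
  length (filter P? (tabulate g)) ≡ ∑ℕ (λ u → ⟦ P? (g u) ⟧)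
length-filter-tabulate P? {zero}  g = refl
length-filter-tabulate P? {suc n} g with does (P? (g zero))
... | true  = cong suc (length-filter-tabulate P? (g ∘ suc))
... | false = length-filter-tabulate P? (g ∘ suc)

#blue-∑ : ∀ {n} (c : Coloring n) → #blue c ≡ ∑ℕ (λ u → ⟦ lookup c u ≟ᶜ blue ⟧)
#blue-∑ []          = refl
#blue-∑ (blue ∷ c)  = cong suc (#blue-∑ c)
#blue-∑ (white ∷ c) = #blue-∑ c

-- Only the bracket at `w` survives. This later counts the one successor and the one predecessor of
-- a node.
∑-∃! : ∀ {n} {P : Fin n → Set} (P? : Decidable P) (w : Fin n) → P w → (∀ u → P u → u ≡ w) →
  ∑ℕ (λ u → ⟦ P? u ⟧) ≡ 1
∑-∃! {suc n} P? zero p uniq with P? zero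
... | no ¬p = ⊥-elim (¬p p)
... | yes _ = cong suc (trans
  (sum-cong-≗ (λ u → ⟦¬⟧ (λ q → 0≢1+n (sym (uniq (suc u) q))) (P? (suc u))))
  (sum-replicate-zero n))
∑-∃! P? (suc w) p uniq = cong₂ ℕ._+_
  (⟦¬⟧ (λ q → 0≢1+n (uniq zero q)) (P? zero))
  (∑-∃! (P? ∘ suc) w p (λ u q → suc-injective (uniq (suc u) q)))

-- Two neighbors split between two colors.

half : ∀ {a b} → a ℕ.+ b ≡ 2 → a ≡ b → a ≡ 1
half {1} refl refl = refl
half {0} refl ()
half {2} refl ()

minority : ∀ {a b} → a ℕ.+ b ≡ 2 → a ℕ.< b → a ≡ 0
minority {0} _ _ = refl
minority {1} refl (s≤s ())
minority {2} refl ()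

⟦≟⟧-total : ∀ x k → ⟦ x ≟ᶜ k ⟧ ℕ.+ ⟦ x ≟ᶜ opposite k ⟧ ≡ 1
⟦≟⟧-total blue  blue  = refl
⟦≟⟧-total blue  white = refl
⟦≟⟧-total white blue  = refl
⟦≟⟧-total white white = refl

-- The process on a 2-regular graph.

module Regular {n : ℕ} (G : SimpleGraph n)
  (2-regular : ∀ v → ∑ℕ (λ u → ⟦ SimpleGraph.adj? G v u ⟧) ≡ 2) where
  open SimpleGraph G
  open RMM G

  #neighbors-∑ : ∀ c v k → #neighbors c v k ≡ ∑ℕ (λ u → ⟦ adj? v u ⟧ ℕ.* ⟦ lookup c u ≟ᶜ k ⟧)
  #neighbors-∑ c v k = trans
    (length-filter-tabulate (λ u → adj? v u ×-dec (lookup c u ≟ᶜ k)) (λ u → u))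
    (sum-cong-≗ (λ u → ⟦×⟧ (adj? v u) (lookup c u ≟ᶜ k)))

  -- Every neighbor has exactly one of the two colors, so the two counts add up to the degree.
  #neighbors-total : ∀ c v k → #neighbors c v k ℕ.+ #neighbors c v (opposite k) ≡ 2
  #neighbors-total c v k = begin
    #neighbors c v k ℕ.+ #neighbors c v (opposite k)
      ≡⟨ cong₂ ℕ._+_ (#neighbors-∑ c v k) (#neighbors-∑ c v (opposite k)) ⟩
    ∑ℕ (λ u → ⟦ adj? v u ⟧ ℕ.* ⟦ lookup c u ≟ᶜ k ⟧) ℕ.+ ∑ℕ (λ u → ⟦ adj? v u ⟧ ℕ.* ⟦ lookup c u ≟ᶜ opposite k ⟧)
      ≡⟨ ∑-distrib-+ (λ u → ⟦ adj? v u ⟧ ℕ.* ⟦ lookup c u ≟ᶜ k ⟧) _ ⟨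
    ∑ℕ (λ u → ⟦ adj? v u ⟧ ℕ.* ⟦ lookup c u ≟ᶜ k ⟧ ℕ.+ ⟦ adj? v u ⟧ ℕ.* ⟦ lookup c u ≟ᶜ opposite k ⟧)
      ≡⟨ sum-cong-≗ (λ u → ℕ.*-distribˡ-+ ⟦ adj? v u ⟧ ⟦ lookup c u ≟ᶜ k ⟧ _) ⟨
    ∑ℕ (λ u → ⟦ adj? v u ⟧ ℕ.* (⟦ lookup c u ≟ᶜ k ⟧ ℕ.+ ⟦ lookup c u ≟ᶜ opposite k ⟧))
      ≡⟨ sum-cong-≗ (λ u → trans (cong (⟦ adj? v u ⟧ ℕ.*_) (⟦≟⟧-total (lookup c u) k)) (ℕ.*-identityʳ _)) ⟩
    ∑ℕ (λ u → ⟦ adj? v u ⟧)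
      ≡⟨ 2-regular v ⟩
    2 ∎

  -- Double counting of the pairs of a node and a blue neighbor: grouped by the blue member, each
  -- blue node contributes its degree.
  ∑-#neighbors-blue : ∀ c → ∑ℕ (λ v → #neighbors c v blue) ≡ #blue c ℕ.+ #blue c
  ∑-#neighbors-blue c = begin
    ∑ℕ (λ v → #neighbors c v blue)
      ≡⟨ sum-cong-≗ (λ v → #neighbors-∑ c v blue) ⟩
    ∑ℕ (λ v → ∑ℕ (λ u → ⟦ adj? v u ⟧ ℕ.* B u))
      ≡⟨ ∑-comm (λ v u → ⟦ adj? v u ⟧ ℕ.* B u) ⟩
    ∑ℕ (λ u → ∑ℕ (λ v → ⟦ adj? v u ⟧ ℕ.* B u))
      -- Symmetry of adjacency turns the inner sum into the degree of `u`.
      ≡⟨ sum-cong-≗ (λ u → sum-cong-≗ (λ v → flip u v)) ⟩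
    ∑ℕ (λ u → ∑ℕ (λ v → B u ℕ.* ⟦ adj? u v ⟧))
      ≡⟨ sum-cong-≗ (λ u → *-distribˡ-sum (B u) (λ v → ⟦ adj? u v ⟧)) ⟨
    ∑ℕ (λ u → B u ℕ.* ∑ℕ (λ v → ⟦ adj? u v ⟧))
      ≡⟨ sum-cong-≗ (λ u → trans (cong (B u ℕ.*_) (2-regular u)) (trans (ℕ.*-comm (B u) 2) (cong (B u ℕ.+_) (ℕ.+-identityʳ (B u))))) ⟩
    ∑ℕ (λ u → B u ℕ.+ B u)
      ≡⟨ ∑-distrib-+ B B ⟩
    ∑ℕ B ℕ.+ ∑ℕ B
      ≡⟨ cong₂ ℕ._+_ (#blue-∑ c) (#blue-∑ c) ⟨
    #blue c ℕ.+ #blue c ∎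
    where
    B : Fin n → ℕ
    B u = ⟦ lookup c u ≟ᶜ blue ⟧
    flip : ∀ u v → ⟦ adj? v u ⟧ ℕ.* B u ≡ B u ℕ.* ⟦ adj? u v ⟧
    flip u v = trans (ℕ.*-comm ⟦ adj? v u ⟧ (B u))
      (cong (B u ℕ.*_) (⟦⟧-⇔ symmetric symmetric (adj? v u) (adj? u v)))

  -- Degree 2 makes the majority rule linear in the neighbor count, which is what allows summation
  -- over the nodes. Generality in `k` also yields `nodeProb-total`.
  nodeProb-½ : ∀ c v k → nodeProb c v k ≡ ½ * fromℕ (#neighbors c v k)
  nodeProb-½ c v k with <-cmp (#neighbors c v k) (#neighbors c v (opposite k))
  -- At the literals 0, 1, 2 the right-hand side evaluates to 0, ½, 1, so finding the count
  -- suffices.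
  ... | tri< a<b _ _ = sym (cong (λ m → ½ * fromℕ m) (minority (#neighbors-total c v k) a<b))
  ... | tri≈ _ a≡b _ = sym (cong (λ m → ½ * fromℕ m) (half (#neighbors-total c v k) a≡b))
  ... | tri> _ _ b<a = sym (cong (λ m → ½ * fromℕ m) a≡2)
    where
    a = #neighbors c v k
    b = #neighbors c v (opposite k)
    a≡2 : a ≡ 2
    a≡2 = begin
      a        ≡⟨ ℕ.+-identityʳ a ⟨
      -- The opposite color is the strict minority here, hence absent.
      a ℕ.+ 0  ≡⟨ cong (a ℕ.+_) (minority (trans (ℕ.+-comm b a) (#neighbors-total c v k)) b<a) ⟨
      a ℕ.+ b  ≡⟨ #neighbors-total c v k ⟩
      2        ∎

  nodeProb-total : ∀ c v → nodeProb c v blue + nodeProb c v white ≡ 1ℚ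
  nodeProb-total c v = begin
    nodeProb c v blue + nodeProb c v white                               ≡⟨ cong₂ _+_ (nodeProb-½ c v blue) (nodeProb-½ c v white) ⟩
    ½ * fromℕ (#neighbors c v blue) + ½ * fromℕ (#neighbors c v white)   ≡⟨ ℚ.*-distribˡ-+ ½ (fromℕ (#neighbors c v blue)) (fromℕ (#neighbors c v white)) ⟨
    ½ * (fromℕ (#neighbors c v blue) + fromℕ (#neighbors c v white))     ≡⟨ cong (½ *_) (fromℕ-+ (#neighbors c v blue) _) ⟨
    ½ * fromℕ (#neighbors c v blue ℕ.+ #neighbors c v white)             ≡⟨ cong (λ m → ½ * fromℕ m) (#neighbors-total c v blue) ⟩
    1ℚ                                                                   ∎

  stepProb-#blue : ∀ c → ∑Coloring (λ d → stepProb c d * fromℕ (#blue d)) ≡ fromℕ (#blue c)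
  stepProb-#blue c = begin
    -- `stepProb c` unfolds to `productMass (nodeProb c)`.
    ∑Coloring (λ d → stepProb c d * fromℕ (#blue d))   ≡⟨ ∑-productMass-#blue (nodeProb c) (nodeProb-total c) ⟩
    ∑ℚ (λ v → nodeProb c v blue)                       ≡⟨ ∑ℚ-cong (λ v → nodeProb-½ c v blue) ⟩
    ∑ℚ (λ v → ½ * fromℕ (#neighbors c v blue))         ≡⟨ ∑ℚ-½fromℕ (λ v → #neighbors c v blue) ⟩
    ½ * fromℕ (∑ℕ (λ v → #neighbors c v blue))         ≡⟨ cong (λ m → ½ * fromℕ m) (∑-#neighbors-blue c) ⟩
    ½ * fromℕ (#blue c ℕ.+ #blue c)                    ≡⟨ cong (½ *_) (fromℕ-+ (#blue c) (#blue c)) ⟩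
    ½ * (fromℕ (#blue c) + fromℕ (#blue c))            ≡⟨ solve 1 (λ x → con ½ :* (x :+ x) := x) refl (fromℕ (#blue c)) ⟩
    fromℕ (#blue c)                                    ∎
    where open +-*-Solver

  law-zero : ∀ c₀ c → law c₀ 0 c ≡ δ c₀ c
  law-zero c₀ c with does (c₀ ≟ c)
  ... | true  = refl
  ... | false = refl

  𝔼-zero : ∀ c₀ X → 𝔼 c₀ 0 X ≡ X c₀
  𝔼-zero c₀ X = trans (∑-cong (λ c → cong (_* X c) (law-zero c₀ c))) (∑-δ c₀ X)

  -- Tower property: conditioning on the coloring after round `t`, by exchanging the two sums.
  𝔼-suc : ∀ c₀ t X → 𝔼 c₀ (suc t) X ≡ 𝔼 c₀ t (λ c → ∑Coloring (λ d → stepProb c d * X d))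
  𝔼-suc c₀ t X = begin
    ∑Coloring (λ d → ∑Coloring (λ c → law c₀ t c * stepProb c d) * X d)
      ≡⟨ ∑-cong (λ d → ∑-*ʳ (X d) (λ c → law c₀ t c * stepProb c d)) ⟨
    ∑Coloring (λ d → ∑Coloring (λ c → law c₀ t c * stepProb c d * X d))
      ≡⟨ ∑-swap (λ d c → law c₀ t c * stepProb c d * X d) ⟩
    ∑Coloring (λ c → ∑Coloring (λ d → law c₀ t c * stepProb c d * X d))
      ≡⟨ ∑-cong (λ c → trans (∑-cong (λ d → ℚ.*-assoc (law c₀ t c) (stepProb c d) (X d))) (∑-*ˡ (law c₀ t c) (λ d → stepProb c d * X d))) ⟩
    ∑Coloring (λ c → law c₀ t c * ∑Coloring (λ d → stepProb c d * X d)) ∎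

  𝔼-#blue : ∀ c₀ t → 𝔼 c₀ t (λ c → fromℕ (#blue c)) ≡ fromℕ (#blue c₀)
  𝔼-#blue c₀ zero    = 𝔼-zero c₀ _
  𝔼-#blue c₀ (suc t) = begin
    𝔼 c₀ (suc t) (λ c → fromℕ (#blue c))                               ≡⟨ 𝔼-suc c₀ t _ ⟩
    𝔼 c₀ t (λ c → ∑Coloring (λ d → stepProb c d * fromℕ (#blue d)))    ≡⟨ ∑-cong (λ c → cong (law c₀ t c *_) (stepProb-#blue c)) ⟩
    𝔼 c₀ t (λ c → fromℕ (#blue c))                                     ≡⟨ 𝔼-#blue c₀ t ⟩
    fromℕ (#blue c₀)                                                   ∎

-- The cycle is 2-regular.

Next-functional : ∀ {n} {v u u′ : Fin n} → Next v u → Next v u′ → u ≡ u′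
Next-functional (inj₁ p) (inj₁ q) = toℕ-injective (trans p (sym q))
Next-functional (inj₂ (_ , p)) (inj₂ (_ , q)) = toℕ-injective (trans p (sym q))
-- If `v` is the last node, then `u` would have index `n`, which is out of range.
Next-functional {u = u} (inj₁ p) (inj₂ (last , _)) = ⊥-elim (ℕ.<⇒≢ (toℕ<n u) (trans p last))
Next-functional {u′ = u} (inj₂ (last , _)) (inj₁ p) = ⊥-elim (ℕ.<⇒≢ (toℕ<n u) (trans p last))

Next-injective : ∀ {n} {v v′ u : Fin n} → Next v u → Next v′ u → v ≡ v′
Next-injective (inj₁ p) (inj₁ q) = toℕ-injective (ℕ.suc-injective (trans (sym p) q))
Next-injective (inj₂ (p , _)) (inj₂ (q , _)) = toℕ-injective (ℕ.suc-injective (trans p (sym q)))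
-- The index of `u` would be both 0 and a successor.
Next-injective (inj₁ p) (inj₂ (_ , q)) = ⊥-elim (ℕ.1+n≢0 (trans (sym p) q))
Next-injective (inj₂ (_ , q)) (inj₁ p) = ⊥-elim (ℕ.1+n≢0 (trans (sym p) q))

successor : ∀ {n} (v : Fin n) → ∃ λ u → Next v u
successor {suc n} v with ℕ.m≤n⇒m<n∨m≡n (toℕ<n v)
... | inj₁ 1+v<n = fromℕ< 1+v<n , inj₁ (toℕ-fromℕ< 1+v<n)
... | inj₂ last  = zero , inj₂ (last , refl)

predecessor : ∀ {n} (u : Fin n) → ∃ λ v → Next v u
predecessor {suc n} zero    = fromℕ< (ℕ.n<1+n n) , inj₂ (cong suc (toℕ-fromℕ< (ℕ.n<1+n n)) , refl)
predecessor {suc n} (suc u) = fromℕ< v<n , inj₁ (cong suc (sym (toℕ-fromℕ< v<n)))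
  where v<n = ℕ.m<n⇒m<1+n (toℕ<n u)

-- Without wrap-around the order of indices forbids mutual succession; with one wrap it forces `n`
-- to be 2, with two wraps 1. The bound on `n` thus keeps successor and predecessor distinct.
Next-asym : ∀ {n} → 3 ℕ.≤ n → {u v : Fin n} → Next u v → ¬ Next v u
Next-asym _ (inj₁ p) (inj₁ q) = ℕ.<-asym (ℕ.≤-reflexive (sym p)) (ℕ.≤-reflexive (sym q))
Next-asym 3≤n (inj₁ p) (inj₂ (last , first)) = 3≰2 (subst (3 ℕ.≤_) (trans (sym last) (cong suc (trans p (cong suc first)))) 3≤n)
  where
  3≰2 : ¬ 3 ℕ.≤ 2
  3≰2 (s≤s (s≤s ()))
Next-asym 3≤n p@(inj₂ _) q@(inj₁ _) = Next-asym 3≤n q p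
Next-asym 3≤n (inj₂ (last , _)) (inj₂ (_ , first)) = 3≰1 (subst (3 ℕ.≤_) (trans (sym last) (cong suc first)) 3≤n)
  where
  3≰1 : ¬ 3 ℕ.≤ 1
  3≰1 (s≤s ())

-- By `Next-asym` the two alternatives of adjacency exclude each other, so the bracket splits into a
-- sum, and each part counts a single node.
cycle-2-regular : ∀ n (3≤n : 3 ℕ.≤ n) v → ∑ℕ (λ u → ⟦ SimpleGraph.adj? (cycle n 3≤n) v u ⟧) ≡ 2
cycle-2-regular n 3≤n v with successor v | predecessor v
... | s , v→s | r , r→v = begin
  ∑ℕ (λ u → ⟦ next? v u ⊎-dec next? u v ⟧)
    ≡⟨ sum-cong-≗ (λ u → ⟦⊎⟧ (Next-asym 3≤n) (next? v u) (next? u v)) ⟩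
  ∑ℕ (λ u → ⟦ next? v u ⟧ ℕ.+ ⟦ next? u v ⟧)
    ≡⟨ ∑-distrib-+ (λ u → ⟦ next? v u ⟧) (λ u → ⟦ next? u v ⟧) ⟩
  ∑ℕ (λ u → ⟦ next? v u ⟧) ℕ.+ ∑ℕ (λ u → ⟦ next? u v ⟧)
    ≡⟨ cong₂ ℕ._+_ (∑-∃! (next? v) s v→s (λ _ p → Next-functional p v→s))
                   (∑-∃! (λ u → next? u v) r r→v (λ _ p → Next-injective p r→v)) ⟩
  2 ∎

theorem4p2 : (n : ℕ) (3≤n : 3 ℕ.≤ n) (p : ℚ) → 0ℚ ≤ p → p ≤ 1ℚ →
    (c₀ : Coloring n) → fromℕ (#blue c₀) ≡ p * fromℕ n →
    (t : ℕ) → RMM.𝔼 (cycle n 3≤n) c₀ t (λ c → fromℕ (#blue c)) ≡ p * fromℕ n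
theorem4p2 n 3≤n p _ _ c₀ b₀≡pn t = trans (𝔼-#blue c₀ t) b₀≡pn
  where open Regular (cycle n 3≤n) (cycle-2-regular n 3≤n)
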